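{- There exist time-inconsistent planning models $(G,w,s,t,\beta)$ in which the number of pairwise distinct costs of feasible $s$-$t$ paths is exponential in the number $n$ of vertices of $G$. (In particular, the difference between the largest and smallest cost of a feasible $s$-$t$ path can be exponential in $n$.)
   Context: A time-inconsistent planning model is a tuple $(G,w,s,t,\beta)$ where $G$ is a finite directed acyclic graph with $n$ vertices, $w:E(G)\to\mathbb{N}$ assigns a cost to each arc, $s,t\in V(G)$ are the start and target vertices, and $\beta\le 1$ is the present-bias parameter. For a vertex $v$ and a $v$-$t$ path $P$ with arcs $e_1,\dots,e_m$ (in order), the perceived cost of $P$ is $\zeta(P)=w(e_1)+\beta\sum_{i=2}^m w(e_i)$, and $\zeta(v)=\min\{\zeta(P): P \text{ a } v\text{ - }t \text{ path}\}$. A $v$-$t$ path of perceived cost $\zeta(v)$ is called a perceived path. The agent starts at $s$; at a vertex $v\neq t$ it chooses some perceived $v$-$t$ path and traverses its first arc, and repeats until reaching $t$. An $s$-$t$ path $v_0=s,v_1,\dots,v_m=t$ is feasible if for every $i<m$ the arc $v_iv_{i+1}$ is the first arc of some perceived $v_i$-$t$ path, i.e., the agent may follow it under some way of breaking ties. The (actual) cost of a path is the sum of $w$ over its arcs. -}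

module Defs where

open import Data.Bool.Base using (Bool; T)
open import Data.Fin.Base using (Fin)
open import Data.Integer.Base using (+_)
open import Data.List.Base using (length)
open import Data.List.Membership.Propositional using (_∈_)
open import Data.List.Relation.Unary.Unique.Propositional using (Unique)
open import Data.Nat.Base as ℕ using (ℕ)
open import Data.Product.Base using (∃-syntax; _×_)
open import Data.Rational.Base as ℚ using (ℚ; 0ℚ; 1ℚ)
open import Data.Unit.Base using (⊤)
open import Function.Base using (flip)
open import Function.Bundles using (_⇔_)
open import Level using (0ℓ)
open import Relation.Binary.Construct.Closure.ReflexiveTransitive using (Star; ε; _◅_)
open import Relation.Binary.Construct.Closure.Transitive using (TransClosure)
open import Relation.Binary.Core using (Rel)
open import Relation.Binary.PropositionalEquality.Core using (_≡_)
open import Relation.Nullary.Negation.Core using (¬_)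
open import Relation.Unary using (Pred)

IsLeast : {A : Set} → Rel A 0ℓ → Pred A 0ℓ → Pred A 0ℓ
IsLeast _≤_ S x = S x × (∀ y → S y → x ≤ y)

IsGreatest : {A : Set} → Rel A 0ℓ → Pred A 0ℓ → Pred A 0ℓ
IsGreatest _≤_ = IsLeast (flip _≤_)

-- S has exactly m elements, counted up to _≡_ of elements (so independently
-- of how many proofs of membership each element has).
HasCardinality : {A : Set} → Pred A 0ℓ → ℕ → Set
HasCardinality {A} S m =
  ∃[ xs ] Unique xs × (∀ (x : A) → x ∈ xs ⇔ S x) × length xs ≡ m

fromℕ : ℕ → ℚ
fromℕ a = + a ℚ./ 1

record Model (n : ℕ) : Set where
  field
    -- Arcs are given by a Boolean adjacency matrix, so there are no parallel arcs.
    adjacent : Fin n → Fin n → Bool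

  Arc : Rel (Fin n) 0ℓ
  Arc u v = T (adjacent u v)

  field
    acyclic : ∀ v → ¬ TransClosure Arc v v
    w       : ∀ {u v} → Arc u v → ℕ
    s t     : Fin n
    β       : ℚ
    0<β     : 0ℚ ℚ.< β
    β≤1     : β ℚ.≤ 1ℚ

  -- By acyclicity every walk is a path.
  Path : Rel (Fin n) 0ℓ
  Path = Star Arc

  cost : ∀ {u v} → Path u v → ℕ
  cost ε       = 0
  cost (e ◅ P) = w e ℕ.+ cost P

  ζ : ∀ {v} → Path v t → ℚ
  ζ ε       = 0ℚ
  ζ (e ◅ P) = fromℕ (w e) ℚ.+ β ℚ.* fromℕ (cost P)

  -- x is the value ζ(v) = min { ζ(P) : P a v-t path }.
  IsPerceivedCost : Fin n → ℚ → Set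
  IsPerceivedCost v = IsLeast ℚ._≤_ (λ x → ∃[ P ] ζ {v} P ≡ x)

  IsPerceivedPath : ∀ {v} → Path v t → Set
  IsPerceivedPath {v} P = IsPerceivedCost v (ζ P)

  -- The agent stops at t; by acyclicity no vertex before the end of a path
  -- to t equals t, so no side condition v ≢ t is needed.
  Feasible : ∀ {v} → Path v t → Set
  Feasible ε       = ⊤
  Feasible (e ◅ P) = (∃[ Q ] IsPerceivedPath (e ◅ Q)) × Feasible P

  FeasibleCost : Pred ℕ 0ℓ
  FeasibleCost c = ∃[ P ] Feasible {s} P × cost P ≡ c

{-# OPTIONS --safe #-}
-- Take β = 1/2 and string together k triangles: from the j-th corner the next
-- corner is reached either directly, at cost 2^j, or by a detour consisting of a
-- free arc followed by an arc of cost 2 · 2^j.  With D the distance from the next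
-- corner to t, the two options have the same perceived cost
-- 2^j + D / 2 = 0 + (2 · 2^j + D) / 2, so every path is feasible.  The direct
-- option contributes 2^j and the detour 2 · 2^j to the actual cost, hence (bijective
-- binary notation) the costs of the s-t paths are the integers from 2^k − 1 to
-- 2 (2^k − 1).  Shifting past the first triangle doubles all costs, which makes
-- everything recursive.
module Submission where

open import Data.Bool.Base using (Bool; true; false; T)
open import Data.Fin.Base as Fin using (Fin; zero; suc; toℕ)
open import Data.Fin.Properties using (toℕ-fromℕ; toℕ≤pred[n])
import Data.Integer.Base as ℤ
import Data.Integer.Properties as ℤ
open import Data.List.Base using (map; upTo)
open import Data.List.Membership.Propositional using (_∈_)
open import Data.List.Membership.Propositional.Properties using (∈-map⁺; ∈-map⁻; ∈-upTo⁺; ∈-upTo⁻)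
open import Data.List.Properties using (length-map; length-upTo)
import Data.List.Relation.Unary.Unique.Propositional.Properties as Unique
open import Data.Nat.Base using (ℕ; zero; suc; _+_; _*_; _≤_; _<_; _∸_; _^_; z≤n; s≤s)
open import Data.Nat.DivMod using (_divMod_; result)
open import Data.Nat.Properties
open import Data.Nat.Solver using (module +-*-Solver)
open import Data.Product.Base using (∃-syntax; Σ-syntax; _×_; _,_)
open import Data.Rational.Base as ℚ using (½; 0ℚ; 1ℚ; toℚᵘ)
import Data.Rational.Properties as ℚ
open import Data.Rational.Unnormalised.Base as ℚᵘ using (mkℚᵘ; *≡*; *≤*)
import Data.Rational.Unnormalised.Properties as ℚᵘ
open import Data.Unit.Base using (tt)
open import Function.Bundles using (mk⇔)
open import Relation.Binary.Construct.Closure.ReflexiveTransitive using (ε; _◅_)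
open import Relation.Binary.Construct.Closure.Transitive using (TransClosure; [_]; _∷_)
open import Relation.Binary.PropositionalEquality using (_≡_; refl; sym; trans; cong; subst; module ≡-Reasoning)
open import Relation.Nullary.Decidable using (from-yes)
open import Relation.Nullary.Negation using (¬_; contradiction)
open import Defs

-- Perceived costs for β = 1/2

-- Over the common denominator 2, which `mkℚᵘ` stores as 1, comparing perceived costs becomes
-- comparing the naturals `2 * a + b`.
toℚᵘ-perceived : ∀ a b →
  toℚᵘ (fromℕ a ℚ.+ ½ ℚ.* fromℕ b) ℚᵘ.≃ mkℚᵘ (ℤ.+ (2 * a + b)) 1
toℚᵘ-perceived a b = begin
  toℚᵘ (fromℕ a ℚ.+ ½ ℚ.* fromℕ b)
    ≈⟨ ℚ.toℚᵘ-homo-+ (fromℕ a) (½ ℚ.* fromℕ b) ⟩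
  toℚᵘ (fromℕ a) ℚᵘ.+ toℚᵘ (½ ℚ.* fromℕ b)
    ≈⟨ ℚᵘ.+-cong (ℚ.toℚᵘ-fromℚᵘ (mkℚᵘ (ℤ.+ a) 0)) (ℚᵘ.≃-trans (ℚ.toℚᵘ-homo-* ½ (fromℕ b)) (ℚᵘ.*-congˡ {toℚᵘ ½} (ℚ.toℚᵘ-fromℚᵘ (mkℚᵘ (ℤ.+ b) 0)))) ⟩
  mkℚᵘ (ℤ.+ a) 0 ℚᵘ.+ mkℚᵘ (ℤ.+ 1) 1 ℚᵘ.* mkℚᵘ (ℤ.+ b) 0
    ≈⟨ *≡* (cong (ℤ._* ℤ.+ 2) numerators) ⟩
  mkℚᵘ (ℤ.+ (2 * a + b)) 1 ∎
  where
  open import Relation.Binary.Reasoning.Setoid ℚᵘ.≃-setoid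
  numerators : ℤ.+ a ℤ.* ℤ.+ 2 ℤ.+ ℤ.+ 1 ℤ.* ℤ.+ b ℤ.* ℤ.+ 1 ≡ ℤ.+ (2 * a + b)
  numerators rewrite ℤ.*-identityʳ (ℤ.+ 1 ℤ.* ℤ.+ b) | ℤ.*-identityˡ (ℤ.+ b)
                   | sym (ℤ.pos-* a 2) | *-comm a 2 = refl

perceived-mono-≤ : ∀ a b c d → 2 * a + b ≤ 2 * c + d →
  fromℕ a ℚ.+ ½ ℚ.* fromℕ b ℚ.≤ fromℕ c ℚ.+ ½ ℚ.* fromℕ d
perceived-mono-≤ a b c d le = ℚ.toℚᵘ-cancel-≤
  (ℚᵘ.≤-respˡ-≃ (ℚᵘ.≃-sym (toℚᵘ-perceived a b))
  (ℚᵘ.≤-respʳ-≃ (ℚᵘ.≃-sym (toℚᵘ-perceived c d))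
  (*≤* (ℤ.*-monoʳ-≤-nonNeg (ℤ.+ 2) (ℤ.+≤+ le)))))

-- The chain of triangles

-- Even indices are corners and odd ones detour midpoints, except that on an even number of vertices
-- the last index is odd and is joined to the last corner by a free arc alone.
adjacent : ∀ {n} → Fin n → Fin n → Bool
adjacent zero          (suc zero)       = true
adjacent zero          (suc (suc zero)) = true
adjacent (suc zero)    (suc (suc zero)) = true
adjacent (suc (suc i)) (suc (suc j))    = adjacent i j
adjacent _             _                = false

-- An inductive view of the Boolean matrix, whose proofs of adjacency carry no information, so that
-- arcs can be treated by recursion.
data Edge : ∀ {n} → Fin n → Fin n → Set where
  free   : ∀ {n} → Edge {2 + n} zero (suc zero)
  back   : ∀ {n} → Edge {3 + n} (suc zero) (suc (suc zero))
  direct : ∀ {n} → Edge {3 + n} zero (suc (suc zero))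
  shift  : ∀ {n} {i j : Fin n} → Edge i j → Edge (suc (suc i)) (suc (suc j))

edge : ∀ {n} (i j : Fin n) → T (adjacent i j) → Edge i j
edge zero          (suc zero)          _ = free
edge zero          (suc (suc zero))    _ = direct
edge (suc zero)    (suc (suc zero))    _ = back
edge (suc (suc i)) (suc (suc j))       e = shift (edge i j e)

weight : ∀ {n} {i j : Fin n} → Edge i j → ℕ
weight free      = 0
weight back      = 2
weight direct    = 1
weight (shift e) = 2 * weight e

edge⇒< : ∀ {n} {i j : Fin n} → Edge i j → toℕ i < toℕ j
edge⇒< free      = s≤s z≤n
edge⇒< back      = s≤s (s≤s z≤n)
edge⇒< direct    = s≤s z≤n
edge⇒< (shift e) = s≤s (s≤s (edge⇒< e))

edge⁺⇒< : ∀ {n} {i j : Fin n} →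
  TransClosure (λ u v → T (adjacent u v)) i j → toℕ i < toℕ j
edge⁺⇒< [ e ]   = edge⇒< (edge _ _ e)
edge⁺⇒< (e ∷ p) = <-trans (edge⇒< (edge _ _ e)) (edge⁺⇒< p)

triangles : ∀ m → Model (suc m)
triangles m = record
  { adjacent = adjacent
  ; acyclic  = λ v p → <-irrefl refl (edge⁺⇒< p)
  ; w        = λ {u} {v} e → weight (edge u v e)
  ; s        = zero
  ; t        = Fin.fromℕ m
  ; β        = ½
  ; 0<β      = from-yes (0ℚ ℚ.<? ½)
  ; β≤1      = from-yes (½ ℚ.≤? 1ℚ)
  }

open module Triangles {m} = Model (triangles m) using (Path; cost; t; ζ; Feasible; FeasibleCost)

-- Paths to the target: extreme costs and feasibility

target-is-sink : ∀ {m} {v : Fin (suc m)} → ¬ Edge (Fin.fromℕ m) v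
target-is-sink {m} {v} e =
  <⇒≱ (edge⇒< e) (subst (toℕ v ≤_) (sym (toℕ-fromℕ m)) (toℕ≤pred[n] v))

shiftPath : ∀ {m} {u v : Fin (suc m)} → Path {m} u v → Path {2 + m} (suc (suc u)) (suc (suc v))
shiftPath ε       = ε
-- `e` can be reused because `adjacent` is unchanged, by computation, when both indices grow by two.
shiftPath (e ◅ P) = e ◅ shiftPath P

cost-shiftPath : ∀ {m} {u v : Fin (suc m)} (P : Path {m} u v) →
  cost {2 + m} (shiftPath P) ≡ 2 * cost {m} P
cost-shiftPath ε = refl
cost-shiftPath {m} (_◅_ {u} {v} e P) = trans
  (cong (2 * weight (edge u v e) +_) (cost-shiftPath P))
  (sym (*-distribˡ-+ 2 (weight (edge u v e)) (cost {m} P)))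

-- The cost of reaching t if crossing the j-th triangle from corner to corner
-- costs a · 2^j: for a = 1 the least cost, for a = 2 the greatest.
remaining : ℕ → ∀ {m} → Fin (suc m) → ℕ
remaining a {0}           _             = 0
remaining a {1}           _             = 0
remaining a {suc (suc m)} zero          = a + 2 * remaining a {m} zero
remaining a {suc (suc m)} (suc zero)    = 2 + 2 * remaining a {m} zero
remaining a {suc (suc m)} (suc (suc i)) = 2 * remaining a {m} i

remaining-target : ∀ a m → remaining a (Fin.fromℕ m) ≡ 0
remaining-target a 0             = refl
remaining-target a 1             = refl
remaining-target a (suc (suc m)) = cong (2 *_) (remaining-target a m)

-- In each triangle the detour costs twice the direct arc.
remaining-double : ∀ m → remaining 2 {m} zero ≡ 2 * remaining 1 {m} zero
remaining-double 0 = refl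
remaining-double 1 = refl
remaining-double (suc (suc m)) = begin
  2 + 2 * remaining 2 {m} zero       ≡⟨ cong (λ x → 2 + 2 * x) (remaining-double m) ⟩
  2 + 2 * (2 * remaining 1 {m} zero) ≡⟨ *-distribˡ-+ 2 1 (2 * remaining 1 {m} zero) ⟨
  2 * (1 + 2 * remaining 1 {m} zero) ∎
  where open ≡-Reasoning

-- `remaining 1` is a potential: summed along a path, these inequalities telescope to a lower bound
-- on its cost. Only the free arc of a full triangle leaves slack.
remaining-1-edge : ∀ {m} {u v : Fin (suc m)} (e : Edge u v) →
  remaining 1 u ≤ weight e + remaining 1 v
remaining-1-edge {1}           free      = z≤n
remaining-1-edge {suc (suc m)} free      = n≤1+n _
remaining-1-edge {suc (suc m)} back      = ≤-refl
remaining-1-edge {suc (suc m)} direct    = ≤-refl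
remaining-1-edge {1} (shift {j = ()} e)
remaining-1-edge {suc (suc m)} (shift {i = i} {j} e) = begin
  2 * remaining 1 i                  ≤⟨ *-monoʳ-≤ 2 (remaining-1-edge e) ⟩
  2 * (weight e + remaining 1 j)     ≡⟨ *-distribˡ-+ 2 (weight e) (remaining 1 j) ⟩
  2 * weight e + 2 * remaining 1 j   ∎
  where open ≤-Reasoning

-- The dual potential, for the upper bound; here only direct arcs leave slack.
remaining-2-edge : ∀ {m} {u v : Fin (suc m)} (e : Edge u v) →
  weight e + remaining 2 v ≤ remaining 2 u
remaining-2-edge {1}           free      = z≤n
remaining-2-edge {suc (suc m)} free      = ≤-refl
remaining-2-edge {suc (suc m)} back      = ≤-refl
remaining-2-edge {suc (suc m)} direct    = n≤1+n _
remaining-2-edge {1} (shift {j = ()} e)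
remaining-2-edge {suc (suc m)} (shift {i = i} {j} e) = begin
  2 * weight e + 2 * remaining 2 j   ≡⟨ *-distribˡ-+ 2 (weight e) (remaining 2 j) ⟨
  2 * (weight e + remaining 2 j)     ≤⟨ *-monoʳ-≤ 2 (remaining-2-edge e) ⟩
  2 * remaining 2 i                  ∎
  where open ≤-Reasoning

remaining-1≤cost : ∀ {m} {v : Fin (suc m)} (P : Path {m} v t) → remaining 1 v ≤ cost P
remaining-1≤cost {m} ε = ≤-reflexive (remaining-target 1 m)
remaining-1≤cost (_◅_ {u} {v} e P) =
  ≤-trans (remaining-1-edge (edge u v e)) (+-monoʳ-≤ (weight (edge u v e)) (remaining-1≤cost P))

cost≤remaining-2 : ∀ {m} {v : Fin (suc m)} (P : Path {m} v t) → cost P ≤ remaining 2 v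
cost≤remaining-2 ε = z≤n
cost≤remaining-2 (_◅_ {u} {v} e P) =
  ≤-trans (+-monoʳ-≤ (weight (edge u v e)) (cost≤remaining-2 P)) (remaining-2-edge (edge u v e))

shortest : ∀ {m} (v : Fin (suc m)) → ∃[ P ] cost {m} {v} {t} P ≡ remaining 1 v
shortest {0} zero       = ε , refl
shortest {1} zero       = tt ◅ ε , refl
shortest {1} (suc zero) = ε , refl
-- The shifted path starts at the next corner, so `tt` stands for the direct arc.
shortest {suc (suc m)} zero =
  let P , eq = shortest {m} zero
  in  tt ◅ shiftPath P , cong (1 +_) (trans (cost-shiftPath P) (cong (2 *_) eq))
shortest {suc (suc m)} (suc zero) =
  let P , eq = shortest {m} zero
  in  tt ◅ shiftPath P , cong (2 +_) (trans (cost-shiftPath P) (cong (2 *_) eq))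
shortest {suc (suc m)} (suc (suc i)) =
  let P , eq = shortest {m} i
  in  shiftPath P , trans (cost-shiftPath P) (cong (2 *_) eq)

-- Each side is twice the perceived cost of an arc continued by a shortest path. Only corners offer
-- a choice, and in the first triangle both options give `2 + 2 * D`, where `2 * D` is the distance
-- from the next corner; later triangles follow by doubling.
indifferent : ∀ {m} {u v v′ : Fin (suc m)} (e : Edge u v) (e′ : Edge u v′) →
  2 * weight e + remaining 1 v ≡ 2 * weight e′ + remaining 1 v′
indifferent free   free   = refl
indifferent free   direct = refl
indifferent direct free   = refl
indifferent direct direct = refl
indifferent back   back   = refl
indifferent {1} (shift {j = ()} e) _
indifferent {suc (suc m)} (shift {j = j} e) (shift {j = j′} e′) = begin
  2 * (2 * weight e) + 2 * remaining 1 j    ≡⟨ *-distribˡ-+ 2 (2 * weight e) _ ⟨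
  2 * (2 * weight e + remaining 1 j)        ≡⟨ cong (2 *_) (indifferent e e′) ⟩
  2 * (2 * weight e′ + remaining 1 j′)      ≡⟨ *-distribˡ-+ 2 (2 * weight e′) _ ⟩
  2 * (2 * weight e′) + 2 * remaining 1 j′  ∎
  where open ≡-Reasoning

feasible : ∀ {m} {v : Fin (suc m)} (P : Path {m} v t) → Feasible P
feasible ε = tt
-- The perceived path that justifies `e` continues with a shortest path, whatever `P` does.
feasible {m} (_◅_ {u} {v} e P) with Q , costQ ← shortest v = (Q , (e ◅ Q , refl) , least) , feasible P
  where
  least : ∀ y → ∃[ R ] ζ {m} {u} R ≡ y → ζ {m} {u} (e ◅ Q) ℚ.≤ y
  -- An empty competitor would put `u` at the target, which `e` cannot leave.
  least _ (ε , refl) = contradiction (edge u v e) target-is-sink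
  least _ (_◅_ {j = v′} e′ R , refl) = perceived-mono-≤ x (cost Q) x′ (cost R) (begin
    2 * x + cost Q          ≡⟨ cong (2 * x +_) costQ ⟩
    2 * x + remaining 1 v   ≡⟨ indifferent (edge u v e) (edge u v′ e′) ⟩
    2 * x′ + remaining 1 v′ ≤⟨ +-monoʳ-≤ (2 * x′) (remaining-1≤cost R) ⟩
    2 * x′ + cost R         ∎)
    where
    open ≤-Reasoning
    x  = weight (edge u v e)
    x′ = weight (edge u v′ e′)

-- The costs of feasible paths

-- Equal to 2^⌊m/2⌋ - 1.
minCost : ℕ → ℕ
minCost m = remaining 1 {m} zero

1+2m≤1+2n⇒m≤n : ∀ {m n} → 1 + 2 * m ≤ 1 + 2 * n → m ≤ n
1+2m≤1+2n⇒m≤n (s≤s le) = *-cancelˡ-≤ 2 le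

2m≤1+2n⇒m≤n : ∀ {m n} → 2 * m ≤ 1 + 2 * n → m ≤ n
2m≤1+2n⇒m≤n {m} {n} le = ≮⇒≥ λ n<m → <⇒≱ (begin-strict
  1 + 2 * n   <⟨ n<1+n _ ⟩
  2 + 2 * n   ≡⟨ *-suc 2 n ⟨
  2 * suc n   ≤⟨ *-monoʳ-≤ 2 n<m ⟩
  2 * m       ∎) le
  where open ≤-Reasoning

-- A detour in the j-th triangle adds 2^j to the least cost, so the binary digits of `r`, lowest
-- first, tell where to take detours.
pathOfCost : ∀ m r → r ≤ minCost m → ∃[ P ] cost {m} {zero} {t} P ≡ minCost m + r
pathOfCost 0 .0 z≤n = ε , refl
pathOfCost 1 .0 z≤n = tt ◅ ε , refl
pathOfCost (suc (suc m)) r r≤ with r divMod 2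
... | result q zero refl rewrite *-comm q 2 =
  let P , eq = pathOfCost m q (2m≤1+2n⇒m≤n r≤)
  in  tt ◅ shiftPath P , (begin
    1 + cost {2 + m} (shiftPath P)  ≡⟨ cong (1 +_) (cost-shiftPath P) ⟩
    1 + 2 * cost P                  ≡⟨ cong (λ x → 1 + 2 * x) eq ⟩
    1 + 2 * (minCost m + q)         ≡⟨ cong (1 +_) (*-distribˡ-+ 2 (minCost m) q) ⟩
    1 + 2 * minCost m + 2 * q       ∎)
  where open ≡-Reasoning
... | result q (suc zero) refl rewrite *-comm q 2 =
  let P , eq = pathOfCost m q (1+2m≤1+2n⇒m≤n r≤)
  -- The midpoint must be named, since neither `tt` determines it.
  in  _◅_ {j = suc zero} tt (tt ◅ shiftPath P) , (begin
    2 + cost {2 + m} (shiftPath P)   ≡⟨ cong (2 +_) (cost-shiftPath P) ⟩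
    2 + 2 * cost P                   ≡⟨ cong (λ x → 2 + 2 * x) eq ⟩
    2 + 2 * (minCost m + q)          ≡⟨ cong (2 +_) (*-distribˡ-+ 2 (minCost m) q) ⟩
    2 + (2 * minCost m + 2 * q)      ≡⟨ cong (1 +_) (+-suc (2 * minCost m) (2 * q)) ⟨
    1 + 2 * minCost m + (1 + 2 * q)  ∎)
  where open ≡-Reasoning

feasibleCost⁺ : ∀ m r → r ≤ minCost m → FeasibleCost {m} (minCost m + r)
feasibleCost⁺ m r r≤ = let P , eq = pathOfCost m r r≤ in P , feasible P , eq

feasibleCost-lower : ∀ m c → FeasibleCost {m} c → minCost m ≤ c
feasibleCost-lower m _ (P , _ , refl) = remaining-1≤cost P

feasibleCost-upper : ∀ m c → FeasibleCost {m} c → c ≤ minCost m + minCost m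
feasibleCost-upper m _ (P , _ , refl) = begin
  cost P                 ≤⟨ cost≤remaining-2 P ⟩
  remaining 2 {m} zero   ≡⟨ remaining-double m ⟩
  2 * minCost m          ≡⟨ cong (λ x → minCost m + x) (+-identityʳ (minCost m)) ⟩
  minCost m + minCost m  ∎
  where open ≤-Reasoning

feasibleCost-cardinality : ∀ m → HasCardinality (FeasibleCost {m}) (suc (minCost m))
feasibleCost-cardinality m =
    costs
  , Unique.map⁺ (+-cancelˡ-≡ L _ _) (Unique.upTo⁺ (suc L))
  , (λ c → mk⇔ to from)
  , trans (length-map (L +_) (upTo (suc L))) (length-upTo (suc L))
  where
  L = minCost m
  costs = map (L +_) (upTo (suc L))
  to : ∀ {c} → c ∈ costs → FeasibleCost {m} c
  to c∈ with r , r∈ , refl ← ∈-map⁻ (L +_) c∈ = feasibleCost⁺ m r (≤-pred (∈-upTo⁻ r∈))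
  from : ∀ {c} → FeasibleCost {m} c → c ∈ costs
  from {c} fc with r , refl ← m≤n⇒∃[o]m+o≡n (feasibleCost-lower m c fc) =
    ∈-map⁺ (L +_) (∈-upTo⁺ (s≤s (+-cancelˡ-≤ L _ _ (feasibleCost-upper m c fc))))

-- Two more vertices multiply the left side by 4 and the right by at least 16, as `minCost` more
-- than doubles. Both base cases have `minCost` 3, whose cube 27 would fall short of 32.
2^≤minCost^4 : ∀ j → 2 ^ (5 + j) ≤ minCost (4 + j) ^ 4
2^≤minCost^4 0 = from-yes (32 ≤? 81)
2^≤minCost^4 1 = from-yes (64 ≤? 81)
2^≤minCost^4 (suc (suc j)) = begin
  2 ^ (7 + j)                     ≡⟨ *-assoc 2 2 (2 ^ (5 + j)) ⟨
  4 * 2 ^ (5 + j)                 ≤⟨ *-mono-≤ {4} {16} (from-yes (4 ≤? 16)) (2^≤minCost^4 j) ⟩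
  16 * L ^ 4                      ≡⟨ fourthPower L ⟩
  (2 * L) ^ 4                     ≤⟨ ^-monoˡ-≤ 4 (n≤1+n (2 * L)) ⟩
  (1 + 2 * L) ^ 4                 ∎
  where
  open ≤-Reasoning
  open +-*-Solver using (solve; con; _:*_; _:^_; _:=_)
  L = minCost (4 + j)
  fourthPower : ∀ x → 16 * x ^ 4 ≡ (2 * x) ^ 4
  fourthPower = solve 1 (λ x → con 16 :* x :^ 4 := (con 2 :* x) :^ 4) refl

theorem1 : ∃[ k ] ∃[ N ] ∀ (n : ℕ) → N ≤ n →
    Σ[ M ∈ Model n ]
    (∃[ m ] HasCardinality (Model.FeasibleCost M) m × 2 ^ n ≤ m ^ k)
    × (∃[ lo ] ∃[ hi ] IsLeast _≤_ (Model.FeasibleCost M) lo × IsGreatest _≤_ (Model.FeasibleCost M) hi × 2 ^ n ≤ (hi ∸ lo) ^ k)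
-- The threshold is 5 because on four vertices `minCost` is 1, too small for any exponent. The
-- spread `hi ∸ lo` is `L`, one less than the number of costs.
theorem1 = 4 , 5 , λ where
  n@(suc (suc (suc (suc (suc j))))) (s≤s (s≤s (s≤s (s≤s (s≤s _))))) →
    let m     = 4 + j
        L     = minCost m
        bound = 2^≤minCost^4 j
    in  triangles m
      , (suc L , feasibleCost-cardinality m , ≤-trans bound (^-monoˡ-≤ 4 (n≤1+n L)))
      , L , L + L
      , (subst FeasibleCost (+-identityʳ L) (feasibleCost⁺ m 0 z≤n) , feasibleCost-lower m)
      , (feasibleCost⁺ m L ≤-refl , feasibleCost-upper m)
      , subst (λ x → 2 ^ n ≤ x ^ 4) (sym (m+n∸n≡m L L)) bound
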